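{- Let $F_{\mathsf g}=\mathcal P^2(-)\times\{0,1\}$ on $\mathbf{Sets}$, and let $\sigma_{\mathsf g}:F_{\mathsf g}\{0,1\}\to\{0,1\}$ be the modality over $(\{0,1\},\le)$ with $\sigma_{\mathsf g}(\Gamma,1)=1$ and $\sigma_{\mathsf g}(\Gamma,0)=\max_{A\in\Gamma}\min_{a\in A}a$. Fix an ordinal $\mathfrak z$ and define: 1) $\mathbf{Ord}_{\le\mathfrak z}=\{\mathfrak a\mid\mathfrak a\text{ is an ordinal with }\mathfrak a\le\mathfrak z\}$ and $r_{\mathsf g,\mathfrak z}:F_{\mathsf g}\mathbf{Ord}_{\le\mathfrak z}\to\mathbf{Ord}_{\le\mathfrak z}$ by $r_{\mathsf g,\mathfrak z}(\Gamma,1)=0$ and $r_{\mathsf g,\mathfrak z}(\Gamma,0)=\min_{A\in\Gamma}\sup_{\mathfrak a\in A}(\mathfrak a\mathbin{\widehat+}1)$, where $\mathfrak a\mathbin{\widehat+}1=\min\{\mathfrak a+1,\mathfrak z\}$; 2) $q_{\mathsf g,\mathfrak z}:\mathbf{Ord}_{\le\mathfrak z}\to\{0,1\}$ by $q_{\mathsf g,\mathfrak z}(\mathfrak z)=0$ and $q_{\mathsf g,\mathfrak z}(\mathfrak a)=1$ for $\mathfrak a<\mathfrak z$; 3) $\mathfrak a\sqsubseteq_{\mathbf{Ord}}\mathfrak b$ iff $\mathfrak a\ge\mathfrak b$, for $\mathfrak a,\mathfrak b\in\mathbf{Ord}_{\le\mathfrak z}$. Then the triple $(r_{\mathsf g,\mathfrak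 z},q_{\mathsf g,\mathfrak z},\sqsubseteq_{\mathbf{Ord}})$ is a ranking domain for $F_{\mathsf g}$ and $\sigma_{\mathsf g}$.
   Context: $\mathcal P$ is the covariant powerset functor (direct images), so $F_{\mathsf g}f(\Gamma,t)=(\{\{f(x)\mid x\in A\}\mid A\in\Gamma\},t)$. Max/min/sup over empty families are taken in the respective posets with the usual order: in $\{0,1\}$, $\max\emptyset=0$, $\min\emptyset=1$; in $\mathbf{Ord}_{\le\mathfrak z}$, $\sup\emptyset=0$, $\min\emptyset=\mathfrak z$. For a functor $F:\mathbf{Sets}\to\mathbf{Sets}$, a coalgebra $c:X\to FX$ and an algebra $a:FA\to A$, put $\Phi_{c,a}(f)=a\circ Ff\circ c$ for $f\in A^X$. Functions into a poset are ordered pointwise. An algebra $r:FR\to R$ is corecursive if for every coalgebra $c:X\to FX$ there is exactly one $f:X\to R$ with $f=r\circ Ff\circ c$. Given a complete lattice $(\Omega,\sqsubseteq_\Omega)$ and an algebra (modality) $\sigma:F\Omega\to\Omega$ such that each $\Phi_{c,\sigma}$ is monotone, a ranking domain for $F$ and $\sigma$ is a triple $(r:FR\to R,\,q:R\to\Omega,\,\sqsubseteq_R)$, with $\sqsubseteq_R$ a partial order on $R$, such that: (1) $q\circ r\sqsubseteq_\Omega\sigma\circ Fq$ pointwise; (2) $(R,\sqsubseteq_R)$ is a complete lattice and $\Phi_{c,r}:R^X\to R^X$ is monotone for each coalgebra $c:X\to FX$; (3) $q$ is monotone, strict ($q(\bot_R)=\bot_\Omega$) and continuous ($q(\bigsqcup_{a\in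 K}a)=\bigsqcup_{a\in K}q(a)$ for each $K\subseteq R$); (4) $r$ is corecursive. -}

module Defs where

open import Axiom.ExcludedMiddle using (ExcludedMiddle)
open import Data.Bool.Base using (Bool; true; false; T; not; if_then_else_; f≤t; b≤b) renaming (_≤_ to _≤ᵇ_)
open import Data.Bool.Properties using (≤-isPartialOrder)
open import Data.Empty.Polymorphic using (⊥; ⊥-elim)
open import Data.Maybe.Base using (Maybe; just; nothing; maybe′)
open import Data.Product using (Σ; ∃-syntax; ∃!; _×_; _,_; proj₁; proj₂)
open import Data.Product.Relation.Binary.Pointwise.NonDependent using (_×ₛ_)
open import Data.Sum.Base using (_⊎_; inj₁; inj₂)
open import Function.Base using (flip)
open import Function.Bundles using (Func; _⟶ₛ_; _⟨$⟩_; _⇔_; mk⇔)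
open import Function.Relation.Binary.Setoid.Equality using (_⇨_)
import Function.Construct.Composition as Comp
import Function.Construct.Identity as Id
open import Level using (Level; Lift; lift; lower; suc; 0ℓ; _⊔_)
open import Relation.Binary.Bundles using (Setoid)
open import Relation.Binary.Core using (Rel)
open import Relation.Binary.Structures using (IsPartialOrder)
open import Relation.Binary.PropositionalEquality as ≡ using (_≡_; refl)
open import Relation.Nullary.Decidable using (yes; no; isYes; toWitness; fromWitness; does-⇔; isYes≗does)

open Setoid using (Carrier)

-- The ambient category of sets is rendered as setoids at a universe level L.

idₛ : ∀ {L} {X : Setoid L L} → X ⟶ₛ X
idₛ {X = X} = Id.function X

infixr 9 _∘ₛ_
_∘ₛ_ : ∀ {L} {X Y Z : Setoid L L} → Y ⟶ₛ Z → X ⟶ₛ Y → X ⟶ₛ Z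
g ∘ₛ f = Comp.function f g

infix 4 _≗ₛ_
_≗ₛ_ : ∀ {L} {X Y : Setoid L L} → Rel (X ⟶ₛ Y) L
_≗ₛ_ {X = X} {Y} = Setoid._≈_ (X ⇨ Y)

record Endofunctor (L : Level) : Set (suc L) where
  field
    F₀       : Setoid L L → Setoid L L
    F₁       : ∀ {X Y : Setoid L L} → X ⟶ₛ Y → F₀ X ⟶ₛ F₀ Y
    F-resp-≗ : ∀ {X Y : Setoid L L} {f g : X ⟶ₛ Y} → f ≗ₛ g → F₁ f ≗ₛ F₁ g
    F-id     : ∀ {X : Setoid L L} → F₁ (idₛ {X = X}) ≗ₛ idₛ
    F-∘      : ∀ {X Y Z : Setoid L L} (f : X ⟶ₛ Y) (g : Y ⟶ₛ Z) →
               F₁ (g ∘ₛ f) ≗ₛ F₁ g ∘ₛ F₁ f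

-- Classically a subset is its characteristic function; this keeps the powerset
-- of a setoid at level L at level L, so that it is an endofunctor.

𝒫 : ∀ {L} → Setoid L L → Setoid L L
𝒫 X = X ⇨ ≡.setoid Bool

Subset : ∀ {L} → Setoid L L → Set L
Subset X = Carrier (𝒫 X)

infix 4 _∈ₛ_
_∈ₛ_ : ∀ {L} {X : Setoid L L} → Carrier X → Subset X → Set
x ∈ₛ A = T (A ⟨$⟩ x)

∅ₛ : ∀ {L} {X : Setoid L L} → Subset X
∅ₛ = record { to = λ _ → false ; cong = λ _ → refl }

module _ {L : Level} where

  record IsCompleteLattice {ℓ} (R : Setoid L L) (_⊑_ : Rel (Carrier R) ℓ) : Set (L ⊔ ℓ) where
    field
      isPartialOrder : IsPartialOrder (Setoid._≈_ R) _⊑_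
      ⨆              : Subset R → Carrier R
      ⨆-upper        : ∀ K {x} → x ∈ₛ K → x ⊑ ⨆ K
      ⨆-least        : ∀ K {u} → (∀ {x} → x ∈ₛ K → x ⊑ u) → ⨆ K ⊑ u
      ⨅              : Subset R → Carrier R
      ⨅-lower        : ∀ K {x} → x ∈ₛ K → ⨅ K ⊑ x
      ⨅-greatest     : ∀ K {l} → (∀ {x} → x ∈ₛ K → l ⊑ x) → l ⊑ ⨅ K

    ⊥ₗ : Carrier R
    ⊥ₗ = ⨆ ∅ₛ

  record CompleteLattice (ℓ : Level) : Set (suc (L ⊔ ℓ)) where
    field
      setoid            : Setoid L L
      _⊑_               : Rel (Carrier setoid) ℓ
      isCompleteLattice : IsCompleteLattice setoid _⊑_
    open IsCompleteLattice isCompleteLattice public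

  module _ (F : Endofunctor L) where
    open Endofunctor F

    Φ : ∀ {X A : Setoid L L} → X ⟶ₛ F₀ X → F₀ A ⟶ₛ A → X ⟶ₛ A → X ⟶ₛ A
    Φ c a f = a ∘ₛ F₁ f ∘ₛ c

    Φ-Monotone : ∀ {ℓ} {A : Setoid L L} → F₀ A ⟶ₛ A → Rel (Carrier A) ℓ → Set (suc L ⊔ ℓ)
    Φ-Monotone {A = A} a _⊑_ =
      ∀ {X : Setoid L L} (c : X ⟶ₛ F₀ X) {f g : X ⟶ₛ A} →
      (∀ x → (f ⟨$⟩ x) ⊑ (g ⟨$⟩ x)) → ∀ x → (Φ c a f ⟨$⟩ x) ⊑ (Φ c a g ⟨$⟩ x)

    Corecursive : ∀ {R : Setoid L L} → F₀ R ⟶ₛ R → Set (suc L)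
    Corecursive {R} r =
      ∀ {X : Setoid L L} (c : X ⟶ₛ F₀ X) → ∃! _≗ₛ_ (λ (f : X ⟶ₛ R) → f ≗ₛ Φ c r f)

module _ {L : Level} (em : ExcludedMiddle L) where

  ⟦_⟧ : Set L → Bool
  ⟦ P ⟧ = isYes (em {P})

  ⟦⟧-cong : ∀ {P Q : Set L} → P ⇔ Q → ⟦ P ⟧ ≡ ⟦ Q ⟧
  ⟦⟧-cong {P} {Q} e =
    ≡.trans (isYes≗does (em {P})) (≡.trans (does-⇔ e em em) (≡.sym (isYes≗does (em {Q}))))

  ≡⇐T : ∀ {a b : Bool} → (T a → T b) → (T b → T a) → a ≡ b
  ≡⇐T {false} {false} _ _ = refl
  ≡⇐T {false} {true}  _ g with () ← g _
  ≡⇐T {true}  {false} f _ with () ← f _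
  ≡⇐T {true}  {true}  _ _ = refl

  image : ∀ {X Y : Setoid L L} → X ⟶ₛ Y → Subset X → Subset Y
  image {X} {Y} f A = record
    { to   = λ y → ⟦ ∃[ x ] x ∈ₛ A × f ⟨$⟩ x ≈ y ⟧
    ; cong = λ y≈y′ → ⟦⟧-cong (mk⇔ (λ (x , x∈A , e) → x , x∈A , trans e y≈y′)
                                   (λ (x , x∈A , e) → x , x∈A , trans e (sym y≈y′)))
    }
    where open Setoid Y

  record IsRankingDomain {ℓ₁ ℓ₂} (F : Endofunctor L) (Ω : CompleteLattice ℓ₁)
      (σ : Endofunctor.F₀ F (CompleteLattice.setoid Ω) ⟶ₛ CompleteLattice.setoid Ω)
      {R : Setoid L L} (r : Endofunctor.F₀ F R ⟶ₛ R) (q : R ⟶ₛ CompleteLattice.setoid Ω)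
      (_⊑R_ : Rel (Carrier R) ℓ₂) : Set (suc L ⊔ ℓ₁ ⊔ ℓ₂) where
    open Endofunctor F
    module Ω = CompleteLattice Ω
    field
      q∘r⊑σ∘Fq            : ∀ ρ → ((q ∘ₛ r) ⟨$⟩ ρ) Ω.⊑ ((σ ∘ₛ F₁ q) ⟨$⟩ ρ)
      R-isCompleteLattice : IsCompleteLattice R _⊑R_
      Φ-monotone          : Φ-Monotone F r _⊑R_
    module R = IsCompleteLattice R-isCompleteLattice
    field
      q-monotone   : ∀ {a b} → a ⊑R b → (q ⟨$⟩ a) Ω.⊑ (q ⟨$⟩ b)
      q-strict     : Setoid._≈_ Ω.setoid (q ⟨$⟩ R.⊥ₗ) Ω.⊥ₗ
      q-continuous : ∀ (K : Subset R) → Setoid._≈_ Ω.setoid (q ⟨$⟩ R.⨆ K) (Ω.⨆ (image q K))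
      corecursive  : Corecursive F r

  infer : ∀ {P : Set L} → T ⟦ P ⟧ → P
  infer = toWitness

  hold : ∀ {P : Set L} → P → T ⟦ P ⟧
  hold = fromWitness

  ∈-cong : ∀ {X : Setoid L L} (A : Subset X) {x y} → Setoid._≈_ X x y → x ∈ₛ A → y ∈ₛ A
  ∈-cong A x≈y = ≡.subst T (Func.cong A x≈y)

  𝒫₁ : ∀ {X Y : Setoid L L} → X ⟶ₛ Y → 𝒫 X ⟶ₛ 𝒫 Y
  𝒫₁ {X} {Y} f = record
    { to   = image f
    ; cong = λ A≈B y → ⟦⟧-cong (mk⇔
        (λ (x , x∈A , e) → x , ≡.subst T (A≈B x) x∈A , e)
        (λ (x , x∈B , e) → x , ≡.subst T (≡.sym (A≈B x)) x∈B , e))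
    }

  𝒫₁-resp-≗ : ∀ {X Y : Setoid L L} {f g : X ⟶ₛ Y} → f ≗ₛ g → 𝒫₁ f ≗ₛ 𝒫₁ g
  𝒫₁-resp-≗ {Y = Y} f≗g A y = ⟦⟧-cong (mk⇔
    (λ (x , x∈A , e) → x , x∈A , trans (sym (f≗g x)) e)
    (λ (x , x∈A , e) → x , x∈A , trans (f≗g x) e))
    where open Setoid Y

  𝒫₁-id : ∀ {X : Setoid L L} → 𝒫₁ (idₛ {X = X}) ≗ₛ idₛ
  𝒫₁-id {X} A y = ≡⇐T
    (λ t → let (x , x∈A , e) = infer t in ∈-cong A e x∈A)
    (λ y∈A → hold (y , y∈A , Setoid.refl X))

  𝒫₁-∘ : ∀ {X Y Z : Setoid L L} (f : X ⟶ₛ Y) (g : Y ⟶ₛ Z) → 𝒫₁ (g ∘ₛ f) ≗ₛ 𝒫₁ g ∘ₛ 𝒫₁ f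
  𝒫₁-∘ {X} {Y} {Z} f g A z = ⟦⟧-cong (mk⇔
    (λ (x , x∈A , e) → f ⟨$⟩ x , hold (x , x∈A , Setoid.refl Y) , e)
    (λ (y , y∈fA , e) → let (x , x∈A , e′) = infer y∈fA in
       x , x∈A , Setoid.trans Z (Func.cong g e′) e))

  F-g : Endofunctor L
  F-g = record
    { F₀       = λ X → 𝒫 (𝒫 X) ×ₛ ≡.setoid Bool
    ; F₁       = λ f → record
      { to   = λ (Γ , t) → 𝒫₁ (𝒫₁ f) ⟨$⟩ Γ , t
      ; cong = λ {x} {y} (Γ≈Δ , s≡t) → Func.cong (𝒫₁ (𝒫₁ f)) {proj₁ x} {proj₁ y} Γ≈Δ , s≡t
      }
    ; F-resp-≗ = λ {X} {Y} {f} {g} f≗g (Γ , t) →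
        𝒫₁-resp-≗ {f = 𝒫₁ f} {𝒫₁ g} (𝒫₁-resp-≗ {f = f} {g} f≗g) Γ , refl
    ; F-id     = λ {X} (Γ , t) →
        (λ A → ≡.trans (𝒫₁-resp-≗ {f = 𝒫₁ (idₛ {X = X})} {idₛ} (𝒫₁-id {X}) Γ A)
                       (𝒫₁-id {𝒫 X} Γ A)) , refl
    ; F-∘      = λ {X} {Y} {Z} f g (Γ , t) →
        (λ A → ≡.trans (𝒫₁-resp-≗ {f = 𝒫₁ (g ∘ₛ f)} {𝒫₁ g ∘ₛ 𝒫₁ f} (𝒫₁-∘ f g) Γ A)
                       (𝒫₁-∘ (𝒫₁ f) (𝒫₁ g) Γ A)) , refl
    }

-- {0,1} lifted to level L, with 0 = false and 1 = true.

module _ {L : Level} where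

  𝟚 : Setoid L L
  𝟚 = ≡.setoid (Lift L Bool)

  infix 4 _≤₂_
  _≤₂_ : Rel (Carrier 𝟚) 0ℓ
  a ≤₂ b = lower a ≤ᵇ lower b

  -- The maximum of K is 1 iff 1 ∈ K; the minimum is 0 iff 0 ∈ K.
  max₂ min₂ : 𝒫 𝟚 ⟶ₛ 𝟚
  max₂ = record
    { to   = λ K → lift (K ⟨$⟩ lift true)
    ; cong = λ K≈K′ → ≡.cong lift (K≈K′ (lift true))
    }
  min₂ = record
    { to   = λ K → lift (not (K ⟨$⟩ lift false))
    ; cong = λ K≈K′ → ≡.cong (λ b → lift (not b)) (K≈K′ (lift false))
    }

  𝟚-completeLattice : CompleteLattice 0ℓ
  𝟚-completeLattice = record
    { setoid            = 𝟚
    ; _⊑_               = _≤₂_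
    ; isCompleteLattice = record
      { isPartialOrder = record
        { isPreorder = record
          { isEquivalence = ≡.isEquivalence
          ; reflexive     = λ { refl → b≤b }
          ; trans         = P.trans
          }
        ; antisym = λ p q → ≡.cong lift (P.antisym p q)
        }
      ; ⨆          = max₂ ⟨$⟩_
      ; ⨆-upper    = λ K {x} → upper K x
      ; ⨆-least    = λ K {u} → least K u
      ; ⨅          = min₂ ⟨$⟩_
      ; ⨅-lower    = λ K {x} → lower′ K x
      ; ⨅-greatest = λ K {l} → greatest K l
      }
    }
    where
    module P = IsPartialOrder ≤-isPartialOrder

    0≤ : ∀ {b} → false ≤ᵇ b
    0≤ {false} = b≤b
    0≤ {true}  = f≤t

    ≤1 : ∀ {b} → b ≤ᵇ true
    ≤1 {false} = f≤t
    ≤1 {true}  = b≤b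

    upper : ∀ K x → x ∈ₛ K → x ≤₂ (max₂ ⟨$⟩ K)
    upper K (lift false) _ = 0≤
    upper K (lift true)  t with K ⟨$⟩ lift true
    ... | true = b≤b

    least : ∀ K u → (∀ {x} → x ∈ₛ K → x ≤₂ u) → (max₂ ⟨$⟩ K) ≤₂ u
    least K u h with K ⟨$⟩ lift true in eq
    ... | false = 0≤
    ... | true  = h {lift true} (≡.subst T (≡.sym eq) _)

    lower′ : ∀ K x → x ∈ₛ K → (min₂ ⟨$⟩ K) ≤₂ x
    lower′ K (lift true)  _ = ≤1
    lower′ K (lift false) t with K ⟨$⟩ lift false
    ... | true = b≤b

    greatest : ∀ K l → (∀ {x} → x ∈ₛ K → l ≤₂ x) → l ≤₂ (min₂ ⟨$⟩ K)
    greatest K l h with K ⟨$⟩ lift false in eq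
    ... | false = ≤1
    ... | true  = h {lift false} (≡.subst T (≡.sym eq) _)

σ-g : ∀ {L} (em : ExcludedMiddle L) → Endofunctor.F₀ (F-g em) 𝟚 ⟶ₛ 𝟚
σ-g em = record
  { to   = to
  ; cong = λ {x} {y} → cong x y
  }
  where
  to : Carrier (Endofunctor.F₀ (F-g em) 𝟚) → Carrier 𝟚
  to (Γ , true)  = lift true
  to (Γ , false) = (max₂ ∘ₛ 𝒫₁ em min₂) ⟨$⟩ Γ

  cong : ∀ x y → Setoid._≈_ (Endofunctor.F₀ (F-g em) 𝟚) x y → to x ≡ to y
  cong (Γ , true)  (Δ , .true)  (_ , refl)   = refl
  cong (Γ , false) (Δ , .false) (Γ≈Δ , refl) = Func.cong (max₂ ∘ₛ 𝒫₁ em min₂) {Γ} {Δ} Γ≈Δ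

-- Aczel's cumulative hierarchy: set I f is {f i ∣ i ∈ I}.

data 𝕍 (ℓ : Level) : Set (suc ℓ) where
  set : (I : Set ℓ) → (I → 𝕍 ℓ) → 𝕍 ℓ

module _ {ℓ : Level} where

  infix 4 _≐_ _∈_ _⊆_

  _≐_ : Rel (𝕍 ℓ) ℓ
  set I f ≐ set J g = (∀ i → ∃[ j ] f i ≐ g j) × (∀ j → ∃[ i ] f i ≐ g j)

  _∈_ : Rel (𝕍 ℓ) ℓ
  x ∈ set J g = ∃[ j ] x ≐ g j

  _⊆_ : Rel (𝕍 ℓ) (suc ℓ)
  x ⊆ y = ∀ {w} → w ∈ x → w ∈ y

  ≐-refl : ∀ {x} → x ≐ x
  ≐-refl {set I f} = (λ i → i , ≐-refl) , (λ i → i , ≐-refl)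

  ≐-sym : ∀ {x y} → x ≐ y → y ≐ x
  ≐-sym {set I f} {set J g} (p , q) =
    (λ j → proj₁ (q j) , ≐-sym (proj₂ (q j))) , (λ i → proj₁ (p i) , ≐-sym (proj₂ (p i)))

  ≐-trans : ∀ {x y z} → x ≐ y → y ≐ z → x ≐ z
  ≐-trans {set I f} {set J g} {set K h} (p , q) (p′ , q′) =
    (λ i → let (j , e) = p i ; (k , e′) = p′ j in k , ≐-trans e e′) ,
    (λ k → let (j , e′) = q′ k ; (i , e) = q j in i , ≐-trans e e′)

  ∈-respˡ : ∀ {x x′ y} → x ≐ x′ → x ∈ y → x′ ∈ y
  ∈-respˡ {y = set J g} e (j , e′) = j , ≐-trans (≐-sym e) e′

  ≐⇒⊆ : ∀ {x y} → x ≐ y → x ⊆ y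
  ≐⇒⊆ {set I f} {set J g} (p , _) (i , e) = proj₁ (p i) , ≐-trans e (proj₂ (p i))

  ⊆-antisym : ∀ {x y} → x ⊆ y → y ⊆ x → x ≐ y
  ⊆-antisym {set I f} {set J g} p q =
    (λ i → p (i , ≐-refl)) ,
    (λ j → let (i , e) = q (j , ≐-refl) in i , ≐-sym e)

  ∅ : 𝕍 ℓ
  ∅ = set ⊥ ⊥-elim

  -- x ∪ {x}
  _⁺ : 𝕍 ℓ → 𝕍 ℓ
  x@(set I f) ⁺ = set (Maybe I) (maybe′ f x)

  ∈⁺⇒ : ∀ {x w} → w ∈ x ⁺ → w ∈ x ⊎ w ≐ x
  ∈⁺⇒ {set I f} (just i  , e) = inj₁ (i , e)
  ∈⁺⇒ {set I f} (nothing , e) = inj₂ e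

  ⊆⁺ : ∀ {x} → x ⊆ x ⁺
  ⊆⁺ {set I f} (i , e) = just i , e

  ≐⇒∈⁺ : ∀ {x w} → w ≐ x → w ∈ x ⁺
  ≐⇒∈⁺ {set I f} e = nothing , e

  ⁺-mono : ∀ {x y} → x ≐ y → x ⁺ ⊆ y ⁺
  ⁺-mono {x} {y} e {w} w∈x⁺ with ∈⁺⇒ {x} w∈x⁺
  ... | inj₁ w∈x = ⊆⁺ {y} {w} (≐⇒⊆ e w∈x)
  ... | inj₂ w≐x = ≐⇒∈⁺ (≐-trans w≐x e)

  separate : 𝕍 ℓ → (𝕍 ℓ → Bool) → 𝕍 ℓ
  separate (set I f) P = set (Σ I λ i → T (P (f i))) (λ (i , _) → f i)

  ∈separate⇒ : ∀ {z P w} → (∀ {x y} → x ≐ y → T (P x) → T (P y)) →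
               w ∈ separate z P → w ∈ z × T (P w)
  ∈separate⇒ {set I f} resp ((i , p) , e) = (i , e) , resp (≐-sym e) p

  ⇒∈separate : ∀ {z P w} → (∀ {x y} → x ≐ y → T (P x) → T (P y)) →
               w ∈ z → T (P w) → w ∈ separate z P
  ⇒∈separate {set I f} resp (i , e) p = (i , resp e p) , e

  -- Von Neumann ordinals: transitive sets of transitive sets (∈ is well-founded on 𝕍).

  Transitive : 𝕍 ℓ → Set (suc ℓ)
  Transitive x = ∀ {y} → y ∈ x → y ⊆ x

  IsOrdinal : 𝕍 ℓ → Set (suc ℓ)
  IsOrdinal x = Transitive x × (∀ {y} → y ∈ x → Transitive y)

record Ordinal (ℓ : Level) : Set (suc ℓ) where
  constructor ordinal
  field
    elements  : 𝕍 ℓ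
    isOrdinal : IsOrdinal elements
open Ordinal

module _ {ℓ : Level} where

  -- On von Neumann ordinals < is ∈ and the induced ≤ is ⊆.
  infix 4 _≤_
  _≤_ : Rel (Ordinal ℓ) (suc ℓ)
  a ≤ b = elements a ⊆ elements b

  0ₒ : Ordinal ℓ
  0ₒ = ordinal ∅ ((λ { (() , _) }) , (λ { (() , _) }))

  _+1 : Ordinal ℓ → Ordinal ℓ
  ordinal x (tr , trs) +1 = ordinal (x ⁺) (tr⁺ , trs⁺)
    where
    tr⁺ : Transitive (x ⁺)
    tr⁺ {y} y∈ {w} w∈y with ∈⁺⇒ {x = x} y∈
    ... | inj₁ y∈x = ⊆⁺ {x = x} {w} (tr y∈x w∈y)
    ... | inj₂ y≐x = ⊆⁺ {x = x} {w} (≐⇒⊆ y≐x w∈y)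

    trs⁺ : ∀ {y} → y ∈ x ⁺ → Transitive y
    trs⁺ {y} y∈ with ∈⁺⇒ {x = x} y∈
    ... | inj₁ y∈x = trs y∈x
    ... | inj₂ y≐x = λ w∈y v∈w → ≐⇒⊆ (≐-sym y≐x) (tr (≐⇒⊆ y≐x w∈y) v∈w)

module _ {ℓ : Level} (em : ExcludedMiddle (suc ℓ)) (z : Ordinal ℓ) where

  Ord≤ : Setoid (suc ℓ) (suc ℓ)
  Ord≤ = record
    { Carrier       = ∃[ a ] a ≤ z
    ; _≈_           = λ (a , _) (b , _) → Lift (suc ℓ) (elements a ≐ elements b)
    ; isEquivalence = record
      { refl  = lift ≐-refl
      ; sym   = λ (lift e) → lift (≐-sym e)
      ; trans = λ (lift e) (lift e′) → lift (≐-trans e e′)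
      }
    }

  open Setoid Ord≤ using (_≈_)

  top : Carrier Ord≤
  top = z , λ w∈z → w∈z

  infix 4 _⊑Ord_
  _⊑Ord_ : Rel (Carrier Ord≤) (suc ℓ)
  (a , _) ⊑Ord (b , _) = b ≤ a

  Below : Subset Ord≤ → 𝕍 ℓ → Set (suc ℓ)
  Below K w = ∃[ a ] a ∈ₛ K × w ∈ elements (proj₁ a)

  BelowAll : Subset Ord≤ → 𝕍 ℓ → Set (suc ℓ)
  BelowAll K w = ∀ a → a ∈ₛ K → w ∈ elements (proj₁ a)

  module Sep (Q : 𝕍 ℓ → Set (suc ℓ))
             (resp : ∀ {x y} → x ≐ y → Q x → Q y)
             (down : ∀ {x y} → y ∈ x → Q x → Q y) where

    resp′ : ∀ {x y} → x ≐ y → T (⟦_⟧ em (Q x)) → T (⟦_⟧ em (Q y))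
    resp′ e t = fromWitness (resp e (toWitness t))

    v : 𝕍 ℓ
    v = separate (elements z) (λ x → ⟦_⟧ em (Q x))

    out : ∀ {w} → w ∈ v → w ∈ elements z × Q w
    out m = let (w∈z , t) = ∈separate⇒ {z = elements z} resp′ m in w∈z , toWitness t

    inn : ∀ {w} → w ∈ elements z → Q w → w ∈ v
    inn w∈z Qw = ⇒∈separate {z = elements z} resp′ w∈z (fromWitness Qw)

    value : Carrier Ord≤
    value = ordinal v
      ( (λ y∈v w∈y → let (y∈z , Qy) = out y∈v in
           inn (proj₁ (isOrdinal z) y∈z w∈y) (down w∈y Qy))
      , (λ y∈v → proj₂ (isOrdinal z) (proj₁ (out y∈v))) )
      , (λ w∈v → proj₁ (out w∈v))

  module Sup (K : Subset Ord≤) = Sep (Below K)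
    (λ e (a , a∈K , m) → a , a∈K , ∈-respˡ e m)
    (λ y∈x (a , a∈K , m) → a , a∈K , proj₁ (isOrdinal (proj₁ a)) m y∈x)

  module Min (K : Subset Ord≤) = Sep (BelowAll K)
    (λ e h a a∈K → ∈-respˡ e (h a a∈K))
    (λ y∈x h a a∈K → proj₁ (isOrdinal (proj₁ a)) (h a a∈K) y∈x)

  -- sup K = ⋃ K, and min K = {w ∈ z ∣ w ∈ a for all a ∈ K}, which is ⋂ K for
  -- nonempty K and z for empty K.
  -- Ord≤-isCompleteLattice shows that these are the joins and meets for ≤.
  sup min : 𝒫 Ord≤ ⟶ₛ Ord≤
  sup = record
    { to   = Sup.value
    ; cong = λ {K} {K′} K≈K′ → lift (⊆-antisym
        (λ m → let (w∈z , a , a∈K , w∈a) = Sup.out K m in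
           Sup.inn K′ w∈z (a , ≡.subst T (K≈K′ a) a∈K , w∈a))
        (λ m → let (w∈z , a , a∈K , w∈a) = Sup.out K′ m in
           Sup.inn K w∈z (a , ≡.subst T (≡.sym (K≈K′ a)) a∈K , w∈a)))
    }
  min = record
    { to   = Min.value
    ; cong = λ {K} {K′} K≈K′ → lift (⊆-antisym
        (λ m → let (w∈z , h) = Min.out K m in
           Min.inn K′ w∈z (λ a a∈K′ → h a (≡.subst T (≡.sym (K≈K′ a)) a∈K′)))
        (λ m → let (w∈z , h) = Min.out K′ m in
           Min.inn K w∈z (λ a a∈K → h a (≡.subst T (K≈K′ a) a∈K))))
    }

  Ord≤-isCompleteLattice : IsCompleteLattice Ord≤ (flip _⊑Ord_)
  Ord≤-isCompleteLattice = record
    { isPartialOrder = record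
      { isPreorder = record
        { isEquivalence = Setoid.isEquivalence Ord≤
        ; reflexive     = λ (lift e) → ≐⇒⊆ e
        ; trans         = λ p q m → q (p m)
        }
      ; antisym = λ p q → lift (⊆-antisym p q)
      }
    ; ⨆          = sup ⟨$⟩_
    ; ⨆-upper    = λ K {x} x∈K m → Sup.inn K (proj₂ x m) (x , x∈K , m)
    ; ⨆-least    = λ K h m → let (_ , a , a∈K , w∈a) = Sup.out K m in h {a} a∈K w∈a
    ; ⨅          = min ⟨$⟩_
    ; ⨅-lower    = λ K {x} x∈K m → proj₂ (Min.out K m) x x∈K
    ; ⨅-greatest = λ K {l} h m → Min.inn K (proj₂ l m) (λ a a∈K → h {a} a∈K m)
    }

  -- a +̂ 1 = min {a + 1, z}
  +̂1 : Ord≤ ⟶ₛ Ord≤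
  +̂1 = record { to = to ; cong = λ {a} {b} → cong a b }
    where
    to : Carrier Ord≤ → Carrier Ord≤
    to (a , _) with em {(a +1) ≤ z}
    ... | yes a+1≤z = (a +1) , a+1≤z
    ... | no  _     = top

    cong : ∀ a b → a ≈ b → to a ≈ to b
    cong (a , _) (b , _) (lift e) with em {(a +1) ≤ z} | em {(b +1) ≤ z}
    ... | yes _ | yes _ = lift (⊆-antisym (⁺-mono e) (⁺-mono (≐-sym e)))
    ... | no _  | no _  = lift ≐-refl
    ... | yes p | no ¬p with () ← ¬p (λ m → p (⁺-mono (≐-sym e) m))
    ... | no ¬p | yes p with () ← ¬p (λ m → p (⁺-mono e m))

  r-g : Endofunctor.F₀ (F-g em) Ord≤ ⟶ₛ Ord≤
  r-g = record { to = to ; cong = λ {x} {y} → cong x y }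
    where
    -- Γ ↦ min over A ∈ Γ of sup over a ∈ A of a +̂ 1
    step : 𝒫 (𝒫 Ord≤) ⟶ₛ Ord≤
    step = min ∘ₛ 𝒫₁ em (sup ∘ₛ 𝒫₁ em +̂1)

    to : Carrier (Endofunctor.F₀ (F-g em) Ord≤) → Carrier Ord≤
    to (Γ , true)  = 0ₒ , λ { (() , _) }
    to (Γ , false) = step ⟨$⟩ Γ

    cong : ∀ x y → Setoid._≈_ (Endofunctor.F₀ (F-g em) Ord≤) x y → to x ≈ to y
    cong (Γ , true)  (Δ , .true)  (_ , refl)   = lift ≐-refl
    cong (Γ , false) (Δ , .false) (Γ≈Δ , refl) = Func.cong step {Γ} {Δ} Γ≈Δ

  q-g : Ord≤ ⟶ₛ 𝟚 {suc ℓ}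
  q-g = record
    { to   = λ a → lift (not (⟦_⟧ em (a ≈ top)))
    ; cong = λ {a} {b} a≈b → ≡.cong (λ t → lift (not t)) (⟦⟧-cong em (mk⇔
        (λ a≈z → Setoid.trans Ord≤ {b} {a} {top} (Setoid.sym Ord≤ {a} {b} a≈b) a≈z)
        (λ b≈z → Setoid.trans Ord≤ {a} {b} {top} a≈b b≈z)))
    }

{-# OPTIONS --safe #-}
module Submission where

-- Everything rests on one formula for the algebra: identifying an ordinal with the
-- set of its predecessors,
--   r (Γ , 0) = { w < z ∣ every A ∈ Γ contains some a with w ≤ a },
-- and r (Γ , 1) = ∅.  If f = r ∘ F f ∘ c, then w ∈ f x therefore depends only on the
-- truth of v ∈ f y for v ∈ w, so ∈-recursion on w defines such an f and ∈-induction on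
-- w shows that it is unique.  The modality has the same shape: σ (Γ , 0) = 0 iff every
-- A ∈ Γ contains 0.

open import Axiom.ExcludedMiddle using (ExcludedMiddle)
open import Data.Bool.Base using (true; false; T; not; f≤t; b≤b)
open import Data.Bool.Properties using (T-≡; ¬-not; not-¬)
open import Data.Product using (_×_; _,_; proj₁; proj₂; ∃-syntax)
open import Data.Sum.Base using (_⊎_; inj₁; inj₂)
open import Data.Unit.Base using (tt)
open import Function.Base using (_∘_)
open import Function.Bundles using (Equivalence; Func; _⟶ₛ_; _⟨$⟩_)
open import Level using (Level; Lift; lift; lower; suc)
open import Relation.Binary.Bundles using (Setoid)
open import Relation.Binary.Core using (Rel)
open import Relation.Binary.PropositionalEquality as ≡ using (_≡_; refl)
open import Relation.Nullary.Decidable using (yes; no)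
open import Relation.Nullary.Negation using (¬_; contradiction)
open import Relation.Unary using (Pred)
import Relation.Binary.Construct.Flip.EqAndOrd as Flip
open import Defs

open Setoid using (Carrier)
open Ordinal
open Endofunctor using (F₀; F₁)

-- Truth values compared by where they vanish

𝟚-ext : ∀ {L} {a b : Carrier (𝟚 {L})} →
        (a ≡ lift false → b ≡ lift false) → (b ≡ lift false → a ≡ lift false) → a ≡ b
𝟚-ext {a = lift false} {b}          f g = ≡.sym (f refl)
𝟚-ext {a = lift true}  {lift false} f g = g refl
𝟚-ext {a = lift true}  {lift true}  f g = refl

≤₂-from-0 : ∀ {L} {a b : Carrier (𝟚 {L})} → (b ≡ lift false → a ≡ lift false) → a ≤₂ b
≤₂-from-0 {a = lift false} {lift false} h = b≤b
≤₂-from-0 {a = lift false} {lift true}  h = f≤t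
≤₂-from-0 {a = lift true}  {lift true}  h = b≤b
≤₂-from-0 {a = lift true}  {lift false} h with () ← h refl

≤₂-to-0 : ∀ {L} {a b : Carrier (𝟚 {L})} → a ≤₂ b → b ≡ lift false → a ≡ lift false
≤₂-to-0 {a = lift false} _  _    = refl
≤₂-to-0 {a = lift true}  () refl

-- One round of the game, and the modality

module _ {L : Level} (em : ExcludedMiddle L) where

  ¬⇒⟦⟧≡false : ∀ {P : Set L} → ¬ P → ⟦_⟧ em P ≡ false
  ¬⇒⟦⟧≡false ¬p = ¬-not (λ t → ¬p (infer em (Equivalence.from T-≡ t)))

  ⟦⟧≡false⇒¬ : ∀ {P : Set L} → ⟦_⟧ em P ≡ false → ¬ P
  ⟦⟧≡false⇒¬ e p = not-¬ e (Equivalence.to T-≡ (hold em p))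

  -- The player choosing A ∈ Γ has not won at ρ = (Γ , t), and the opponent, who
  -- chooses a ∈ A, can enforce P.
  record Forced {Y : Setoid L L} (ρ : Carrier (F₀ (F-g em) Y))
                (P : Pred (Carrier Y) L) : Set L where
    constructor _,_
    field
      undecided : proj₂ ρ ≡ false
      response  : (A : Subset Y) → A ∈ₛ proj₁ ρ → ∃[ a ] a ∈ₛ A × P a

  Forced-mono : ∀ {Y : Setoid L L} (ρ : Carrier (F₀ (F-g em) Y))
                {P Q : Pred (Carrier Y) L} →
                Forced ρ P → (∀ {a} → P a → Q a) → Forced ρ Q
  Forced-mono ρ (t≡f , h) P⇒Q =
    t≡f , λ A A∈Γ → let (a , a∈A , Pa) = h A A∈Γ in a , a∈A , P⇒Q Pa

  module _ {X Y : Setoid L L} (f : X ⟶ₛ Y) (P : Pred (Carrier Y) L)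
           (resp : ∀ {a b} → Setoid._≈_ Y a b → P a → P b) where

    -- Answer `A` by answering its direct image, then pull the response back along `f`. Membership
    -- in an image holds only up to the equality of `Y`, hence `resp`.
    Forced-F₁⁻ : ∀ ρ → Forced (F₁ (F-g em) f ⟨$⟩ ρ) P → Forced ρ (λ x → P (f ⟨$⟩ x))
    Forced-F₁⁻ ρ (t≡f , h) = t≡f , λ A A∈Γ →
      let (b , b∈fA , Pb)  = h (image em f A) (hold em (A , A∈Γ , λ _ → refl))
          (x , x∈A , fx≈b) = infer em b∈fA
      in x , x∈A , resp (Setoid.sym Y fx≈b) Pb

    Forced-F₁⁺ : ∀ ρ → Forced ρ (λ x → P (f ⟨$⟩ x)) → Forced (F₁ (F-g em) f ⟨$⟩ ρ) P
    Forced-F₁⁺ ρ (t≡f , h) = t≡f , λ B B∈fΓ →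
      let (A , A∈Γ , fA≈B) = infer em B∈fΓ
          (x , x∈A , Pfx)  = h A A∈Γ
      in f ⟨$⟩ x , ≡.subst T (fA≈B (f ⟨$⟩ x)) (hold em (x , x∈A , Setoid.refl Y)) , Pfx

  IsFalse : Pred (Carrier (𝟚 {L})) L
  IsFalse a = a ≡ lift false

  IsFalse-resp : {a b : Carrier (𝟚 {L})} → a ≡ b → IsFalse a → IsFalse b
  IsFalse-resp refl a≡0 = a≡0

  σ≡0⇒Forced : ∀ ρ → IsFalse (σ-g em ⟨$⟩ ρ) → Forced ρ IsFalse
  σ≡0⇒Forced (Γ , false) e = refl , λ A A∈Γ → lift false , 0∈ A A∈Γ , refl
    where
    0∈ : ∀ A → A ∈ₛ Γ → T (A ⟨$⟩ lift false)
    0∈ A A∈Γ with A ⟨$⟩ lift false in eq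
    ... | true  = tt
    -- If 0 were not in `A`, its minimum would be 1, and `A` would contradict that the maximum is 0.
    ... | false = ⟦⟧≡false⇒¬ (≡.cong lower e) (A , A∈Γ , ≡.cong (λ b → lift (not b)) eq)

  Forced⇒σ≡0 : ∀ ρ → Forced ρ IsFalse → IsFalse (σ-g em ⟨$⟩ ρ)
  Forced⇒σ≡0 (Γ , false) (_ , h) =
    ≡.cong lift (¬⇒⟦⟧≡false λ (A , A∈Γ , minA≡1) → 0∉ A A∈Γ minA≡1)
    where
    0∉ : ∀ A → A ∈ₛ Γ → ¬ (min₂ ⟨$⟩ A ≡ lift true)
    0∉ A A∈Γ e with h A A∈Γ
    ... | lift false , 0∈A , refl with A ⟨$⟩ lift false
    ...   | true with () ← e

  -- Where `g` is 0 so is `f`, so a response that works for `g` also works for `f`.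
  σ-Φ-monotone : Φ-Monotone (F-g em) (σ-g em) _≤₂_
  σ-Φ-monotone c {f} {g} f≤g x = ≤₂-from-0
    ( Forced⇒σ≡0 _
    ∘ Forced-F₁⁺ f IsFalse IsFalse-resp (c ⟨$⟩ x)
    ∘ (λ g-forced → Forced-mono (c ⟨$⟩ x) g-forced (λ {y} → ≤₂-to-0 (f≤g y)))
    ∘ Forced-F₁⁻ g IsFalse IsFalse-resp (c ⟨$⟩ x)
    ∘ σ≡0⇒Forced _ )

-- Comparability of von Neumann ordinals

module _ {ℓ : Level} where

  IsOrdinal-∈ : {x y : 𝕍 ℓ} → IsOrdinal x → y ∈ x → IsOrdinal y
  IsOrdinal-∈ (tr , trs) y∈x = trs y∈x , λ w∈y → trs (tr y∈x w∈y)

  IsOrdinal-resp : {x y : 𝕍 ℓ} → x ≐ y → IsOrdinal x → IsOrdinal y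
  IsOrdinal-resp x≐y (tr , trs) =
    (λ v∈y w∈v → ≐⇒⊆ x≐y (tr (≐⇒⊆ (≐-sym x≐y) v∈y) w∈v)) , (λ v∈y → trs (≐⇒⊆ (≐-sym x≐y) v∈y))

  Comparable : Rel (𝕍 ℓ) ℓ
  Comparable x y = x ∈ y ⊎ x ≐ y ⊎ y ∈ x

  -- Suppose neither set belongs to the other. An element of one that equals or contains the other
  -- would, by transitivity, put the other into the first. So each element of either lies in the
  -- other, and extensionality gives equality.
  comparable-step : ExcludedMiddle (suc ℓ) → ∀ {I J f g} →
    Transitive (set I f) → Transitive (set J g) →
    (∀ i → Comparable (f i) (set J g)) → (∀ j → Comparable (set I f) (g j)) →
    Comparable (set I f) (set J g)
  comparable-step em {I} {J} {f} {g} trx try f-comp g-comp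
    with em {Lift _ (set I f ∈ set J g)} | em {Lift _ (set J g ∈ set I f)}
  ... | yes (lift x∈y) | _              = inj₁ x∈y
  ... | no _           | yes (lift y∈x) = inj₂ (inj₂ y∈x)
  ... | no x∉y         | no y∉x         =
    inj₂ (inj₁ (fi∈y , λ j → let (i , e) = gj∈x j in i , ≐-sym e))
    where
    fi∈y : ∀ i → f i ∈ set J g
    fi∈y i with f-comp i
    ... | inj₁ fi∈y        = fi∈y
    ... | inj₂ (inj₁ fi≐y) = contradiction (lift (i , ≐-sym fi≐y)) y∉x
    ... | inj₂ (inj₂ y∈fi) = contradiction (lift (trx (i , ≐-refl) y∈fi)) y∉x

    gj∈x : ∀ j → g j ∈ set I f
    gj∈x j with g-comp j
    ... | inj₁ x∈gj        = contradiction (lift (try (j , ≐-refl) x∈gj)) x∉y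
    ... | inj₂ (inj₁ x≐gj) = contradiction (lift (j , x≐gj)) x∉y
    ... | inj₂ (inj₂ gj∈x) = gj∈x

  ∈-trichotomy : ExcludedMiddle (suc ℓ) → (x y : 𝕍 ℓ) → IsOrdinal x → IsOrdinal y →
                 Comparable x y
  ∈-trichotomy em x@(set I f) y@(set J g) ox oy = comparable-step em (proj₁ ox) (proj₁ oy)
    (λ i → ∈-trichotomy em (f i) y (IsOrdinal-∈ ox (i , ≐-refl)) oy)
    (λ j → ∈-trichotomy em x (g j) ox (IsOrdinal-∈ oy (j , ≐-refl)))

-- Membership in the values of `r`

module _ {ℓ : Level} (em : ExcludedMiddle (suc ℓ)) (z : Ordinal ℓ) where

  private
    R : Setoid (suc ℓ) (suc ℓ)
    R = Ord≤ em z

    F : Endofunctor (suc ℓ)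
    F = F-g em

    r : F₀ F R ⟶ₛ R
    r = r-g em z

    q : R ⟶ₛ 𝟚 {suc ℓ}
    q = q-g em z

    el : Carrier R → 𝕍 ℓ
    el a = elements (proj₁ a)

    sups : Subset (𝒫 R) → Subset R
    sups = image em (sup em z ∘ₛ 𝒫₁ em (+̂1 em z))

    ord : ∀ {w} → w ∈ elements z → IsOrdinal w
    ord = IsOrdinal-∈ (isOrdinal z)

  ⊆el-resp : ∀ {w} {a b : Carrier R} → Setoid._≈_ R a b → w ⊆ el a → w ⊆ el b
  ⊆el-resp (lift a≐b) w⊆a v∈w = ≐⇒⊆ a≐b (w⊆a v∈w)

  -- With its converse below: for w < z, w < a +̂ 1 iff w ≤ a. When the successor is truncated, `a`
  -- is not a member of `z`, so trichotomy leaves z ≤ a.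
  ∈+̂1⇒⊆ : ∀ a {w} → w ∈ el (+̂1 em z ⟨$⟩ a) → w ⊆ el a
  ∈+̂1⇒⊆ (a , a≤z) {w} w∈ with em {(a +1) ≤ z}
  ... | yes _ with ∈⁺⇒ {x = elements a} w∈
  ...   | inj₁ w∈a = proj₁ (isOrdinal a) w∈a
  ...   | inj₂ w≐a = ≐⇒⊆ w≐a
  ∈+̂1⇒⊆ (a , a≤z) {w} w∈z | no a+1≰z
    with ∈-trichotomy em (elements a) (elements z) (isOrdinal a) (isOrdinal z)
  ... | inj₁ a∈z = contradiction (λ {v} → a+1≤z {v}) a+1≰z
    where
    a+1≤z : (a +1) ≤ z
    a+1≤z {v} v∈ with ∈⁺⇒ {x = elements a} v∈
    ... | inj₁ v∈a = a≤z v∈a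
    ... | inj₂ v≐a = ∈-respˡ (≐-sym v≐a) a∈z
  ... | inj₂ (inj₁ a≐z) = λ v∈w → ≐⇒⊆ (≐-sym a≐z) (proj₁ (isOrdinal z) w∈z v∈w)
  ... | inj₂ (inj₂ z∈a) = λ v∈w → proj₁ (isOrdinal a) z∈a (proj₁ (isOrdinal z) w∈z v∈w)

  ⊆⇒∈+̂1 : ∀ a {w} → w ∈ elements z → w ⊆ el a → w ∈ el (+̂1 em z ⟨$⟩ a)
  ⊆⇒∈+̂1 (a , a≤z) {w} w∈z w⊆a with em {(a +1) ≤ z}
  ... | no _ = w∈z
  ... | yes _ with ∈-trichotomy em w (elements a) (ord w∈z) (isOrdinal a)
  ...   | inj₁ w∈a        = ⊆⁺ {x = elements a} w∈a
  ...   | inj₂ (inj₁ w≐a) = ≐⇒∈⁺ w≐a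
  -- Transitivity of `w` turns `a∈w` into the inclusion opposite to `w⊆a`.
  ...   | inj₂ (inj₂ a∈w) = ≐⇒∈⁺ (⊆-antisym w⊆a (proj₁ (ord w∈z) a∈w))

  -- Being below the minimum puts `w` in the supremum for each `A`, hence in some a +̂ 1 with a ∈ A.
  ∈r⇒Forced : ∀ ρ {w} → w ∈ el (r ⟨$⟩ ρ) → Forced em ρ (λ a → w ⊆ el a)
  ∈r⇒Forced (Γ , true) (() , _)
  ∈r⇒Forced (Γ , false) {w} w∈r = refl , λ A A∈Γ →
    let A+̂1                    = image em (+̂1 em z) A
        s                      = sup em z ⟨$⟩ A+̂1
        w∈s                    = proj₂ (Min.out em z (sups Γ) w∈r) s
                                   (hold em (A , A∈Γ , Setoid.refl R {s}))
        (_ , b , b∈A+̂1 , w∈b)  = Sup.out em z A+̂1 w∈s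
        (a , a∈A , lift a+̂1≐b) = infer em b∈A+̂1
    in a , a∈A , ∈+̂1⇒⊆ a (≐⇒⊆ (≐-sym a+̂1≐b) w∈b)

  -- The bound w ∈ z matches the default min ∅ = z: for empty `Γ` the responses impose nothing.
  Forced⇒∈r : ∀ ρ {w} → w ∈ elements z → Forced em ρ (λ a → w ⊆ el a) → w ∈ el (r ⟨$⟩ ρ)
  Forced⇒∈r (Γ , false) {w} w∈z (_ , h) = Min.inn em z (sups Γ) w∈z λ b b∈ →
    let (A , A∈Γ , lift sup≐b) = infer em b∈
        (a , a∈A , w⊆a)        = h A A∈Γ
        a+̂1                    = +̂1 em z ⟨$⟩ a
    in ≐⇒⊆ sup≐b (Sup.inn em z (image em (+̂1 em z) A) w∈z
         (a+̂1 , hold em (a , a∈A , Setoid.refl R {a+̂1}) , ⊆⇒∈+̂1 a w∈z w⊆a))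

  module _ {X : Setoid (suc ℓ) (suc ℓ)} (f : X ⟶ₛ R) (ρ : Carrier (F₀ F X)) {w : 𝕍 ℓ} where

    ∈r∘F₁⇒Forced : w ∈ el (r ⟨$⟩ (F₁ F f ⟨$⟩ ρ)) → Forced em ρ (λ x → w ⊆ el (f ⟨$⟩ x))
    ∈r∘F₁⇒Forced w∈r = Forced-F₁⁻ em f (λ a → w ⊆ el a)
      (λ {a} {b} → ⊆el-resp {w} {a} {b}) ρ (∈r⇒Forced (F₁ F f ⟨$⟩ ρ) w∈r)

    Forced⇒∈r∘F₁ : w ∈ elements z → Forced em ρ (λ x → w ⊆ el (f ⟨$⟩ x)) →
                   w ∈ el (r ⟨$⟩ (F₁ F f ⟨$⟩ ρ))
    Forced⇒∈r∘F₁ w∈z h = Forced⇒∈r (F₁ F f ⟨$⟩ ρ) w∈z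
      (Forced-F₁⁺ em f (λ a → w ⊆ el a) (λ {a} {b} → ⊆el-resp {w} {a} {b}) ρ h)

  r-Φ-monotone : Φ-Monotone F r (_⊑Ord_ em z)
  r-Φ-monotone c {f} {g} f⊑g x {w} w∈ =
    Forced⇒∈r∘F₁ f (c ⟨$⟩ x) {w} (proj₂ (Φ F c r g ⟨$⟩ x) w∈)
      (Forced-mono em (c ⟨$⟩ x) (∈r∘F₁⇒Forced g (c ⟨$⟩ x) {w} w∈)
        (λ {y} w⊆gy v∈w → f⊑g y (w⊆gy v∈w)))

  -- The zeros of `q` and the reversed lattice

  q≡0⇒z≤ : ∀ a → IsFalse em (q ⟨$⟩ a) → z ≤ proj₁ a
  q≡0⇒z≤ a e w∈z with em {Setoid._≈_ R a (top em z)}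
  ... | yes (lift a≐z) = ≐⇒⊆ (≐-sym a≐z) w∈z

  z≤⇒q≡0 : ∀ a → z ≤ proj₁ a → IsFalse em (q ⟨$⟩ a)
  z≤⇒q≡0 (a , a≤z) z≤a with em {Setoid._≈_ R (a , a≤z) (top em z)}
  ... | yes _  = refl
  ... | no a≉z = contradiction (lift (⊆-antisym a≤z z≤a)) a≉z

  ⊑Ord-isCompleteLattice : IsCompleteLattice R (_⊑Ord_ em z)
  ⊑Ord-isCompleteLattice = record
    { isPartialOrder = Flip.isPartialOrder L.isPartialOrder
    ; ⨆              = L.⨅
    ; ⨆-upper        = λ K {x} → L.⨅-lower K {x}
    ; ⨆-least        = λ K {u} → L.⨅-greatest K {u}
    ; ⨅              = L.⨆
    ; ⨅-lower        = λ K {x} → L.⨆-upper K {x}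
    ; ⨅-greatest     = λ K {l} → L.⨆-least K {l}
    }
    where module L = IsCompleteLattice (Ord≤-isCompleteLattice em z)

  -- Existence and uniqueness of the fixed point

  module _ {X : Setoid (suc ℓ) (suc ℓ)} (c : X ⟶ₛ F₀ F X) where

    open Setoid X using (_≈_)

    -- What w ∈ f x must mean, for w ∈ z, when `f` is a fixed point: the clause w ⊆ f y is replaced
    -- by the recursive condition on the members of `w`. Quantifying over indices keeps the
    -- recursion structural.
    Ranked : 𝕍 ℓ → Carrier X → Set (suc ℓ)
    Ranked (set I g) x = Forced em (c ⟨$⟩ x) (λ y → ∀ i → Ranked (g i) y)

    Ranked-resp-≐ : ∀ {v w x} → v ≐ w → Ranked v x → Ranked w x
    Ranked-resp-≐ {set I f} {set J g} {x} (_ , q) ranked = Forced-mono em (c ⟨$⟩ x) ranked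
      λ h j → let (i , fi≐gj) = q j in Ranked-resp-≐ fi≐gj (h i)

    Ranked⇒Forced : ∀ w {x} → Ranked w x →
                    Forced em (c ⟨$⟩ x) (λ y → ∀ {v} → v ∈ w → Ranked v y)
    Ranked⇒Forced (set I f) {x} ranked = Forced-mono em (c ⟨$⟩ x) ranked
      λ h (i , v≐fi) → Ranked-resp-≐ (≐-sym v≐fi) (h i)

    Forced⇒Ranked : ∀ w {x} →
                    Forced em (c ⟨$⟩ x) (λ y → ∀ {v} → v ∈ w → Ranked v y) → Ranked w x
    Forced⇒Ranked (set I f) {x} forced = Forced-mono em (c ⟨$⟩ x) forced λ h i → h (i , ≐-refl)

    Ranked-resp-≈ : ∀ w {x y} → x ≈ y → Ranked w x → Ranked w y
    Ranked-resp-≈ (set I f) {x} {y} x≈y (t≡f , h) =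
      let (Γ≈Δ , s≡t) = Func.cong c x≈y in
      ≡.trans (≡.sym s≡t) t≡f , λ A A∈Δ → h A (≡.subst T (≡.sym (Γ≈Δ A)) A∈Δ)

    -- Members of `v` are members of `w`, so the same responses serve.
    Ranked-∈ : ∀ {v w x} → Transitive w → v ∈ w → Ranked w x → Ranked v x
    Ranked-∈ {v} {w} {x} tr v∈w h = Forced⇒Ranked v
      (Forced-mono em (c ⟨$⟩ x) (Ranked⇒Forced w h) (λ k u∈v → k (tr v∈w u∈v)))

    -- Ranked is downward closed on transitive sets only, but Sep asks for a predicate
    -- that is downward closed on all of 𝕍; hence the conjunct IsOrdinal.
    module Rank (x : Carrier X) = Sep em z (λ w → IsOrdinal w × Ranked w x)
      (λ v≐w (ov , h) → IsOrdinal-resp v≐w ov , Ranked-resp-≐ v≐w h)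
      (λ v∈w (ow , h) → IsOrdinal-∈ ow v∈w , Ranked-∈ (proj₁ ow) v∈w h)

    rank : X ⟶ₛ R
    rank = record
      { to   = Rank.value
      ; cong = λ x≈y → lift (⊆-antisym (rank-mono x≈y) (rank-mono (Setoid.sym X x≈y)))
      }
      where
      rank-mono : ∀ {x y} → x ≈ y → Rank.v x ⊆ Rank.v y
      rank-mono {x} {y} x≈y {w} w∈ =
        let (w∈z , ow , h) = Rank.out x w∈ in Rank.inn y w∈z (ow , Ranked-resp-≈ w x≈y h)

    rank-fixed : rank ≗ₛ Φ F c r rank
    rank-fixed x = lift (⊆-antisym to from)
      where
      to : Rank.v x ⊆ el (Φ F c r rank ⟨$⟩ x)
      to {w} w∈ = let (w∈z , ow , h) = Rank.out x w∈ in
        Forced⇒∈r∘F₁ rank (c ⟨$⟩ x) {w} w∈z (Forced-mono em (c ⟨$⟩ x) (Ranked⇒Forced w h)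
          -- Entering the rank of `y` takes all three: `v` is below `z`, an ordinal, and ranked at
          -- `y`.
          (λ {y} k v∈w → Rank.inn y (proj₁ (isOrdinal z) w∈z v∈w) (IsOrdinal-∈ ow v∈w , k v∈w)))

      from : el (Φ F c r rank ⟨$⟩ x) ⊆ Rank.v x
      from {w} w∈ = let w∈z = proj₂ (Φ F c r rank ⟨$⟩ x) w∈ in
        Rank.inn x w∈z (ord w∈z , Forced⇒Ranked w (Forced-mono em (c ⟨$⟩ x)
          (∈r∘F₁⇒Forced rank (c ⟨$⟩ x) {w} w∈)
          (λ {y} w⊆ v∈w → proj₂ (proj₂ (Rank.out y (w⊆ v∈w))))))

    -- Induction on `w`, for all `x` at once: unfold `f`, turn w ⊆ f y into w ⊆ g y by the
    -- hypothesis for the members of `w`, and fold `g`. Swapping `f` and `g` yields uniqueness.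
    fixed-≤ : (f g : X ⟶ₛ R) → f ≗ₛ Φ F c r f → g ≗ₛ Φ F c r g →
              ∀ w x → w ∈ el (f ⟨$⟩ x) → w ∈ el (g ⟨$⟩ x)
    fixed-≤ f g f-fixed g-fixed w@(set I h) x w∈fx =
      ≐⇒⊆ (≐-sym (lower (g-fixed x)))
        (Forced⇒∈r∘F₁ g (c ⟨$⟩ x) {w} (proj₂ (f ⟨$⟩ x) w∈fx)
          (Forced-mono em (c ⟨$⟩ x)
            (∈r∘F₁⇒Forced f (c ⟨$⟩ x) {w} (≐⇒⊆ (lower (f-fixed x)) w∈fx))
            (λ {y} w⊆fy (i , v≐hi) → ∈-respˡ (≐-sym v≐hi)
              (fixed-≤ f g f-fixed g-fixed (h i) y (w⊆fy (i , ≐-refl))))))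

  r-corecursive : Corecursive F r
  r-corecursive c = rank c , rank-fixed c , λ {g} g-fixed x → lift (⊆-antisym
    (fixed-≤ c (rank c) g (rank-fixed c) g-fixed _ x)
    (fixed-≤ c g (rank c) g-fixed (rank-fixed c) _ x))

  -- Compatibility of `q` with the algebras and with joins

  q∘r≤σ∘Fq : ∀ ρ → (q ⟨$⟩ (r ⟨$⟩ ρ)) ≤₂ (σ-g em ⟨$⟩ (F₁ F q ⟨$⟩ ρ))
  q∘r≤σ∘Fq ρ = ≤₂-from-0 λ σ≡0 → z≤⇒q≡0 (r ⟨$⟩ ρ) λ {w} w∈z →
    Forced⇒∈r ρ {w} w∈z (Forced-mono em ρ
      (Forced-F₁⁻ em q (IsFalse em) (IsFalse-resp em) ρ (σ≡0⇒Forced em _ σ≡0))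
      -- A response with q a = 0 has z ≤ a, so it is at least every w < z at once.
      (λ {a} qa≡0 v∈w → q≡0⇒z≤ a qa≡0 (proj₁ (isOrdinal z) w∈z v∈w)))

  -- Joins of the reversed order are minima. The minimum reaches `z` iff every member of `K` does,
  -- that is, iff 1 is not in the image of `K` under `q`.
  q-min : ∀ K → q ⟨$⟩ (min em z ⟨$⟩ K) ≡ max₂ ⟨$⟩ image em q K
  q-min K = 𝟚-ext
    (λ q≡0 → ≡.cong lift (¬⇒⟦⟧≡false em λ (a , a∈K , qa≡1) → 0≢1 (≡.trans (≡.sym
      (z≤⇒q≡0 a λ w∈z → proj₂ (Min.out em z K (q≡0⇒z≤ (min em z ⟨$⟩ K) q≡0 w∈z)) a a∈K))
      qa≡1)))
    (λ max≡0 → z≤⇒q≡0 (min em z ⟨$⟩ K) λ w∈z → Min.inn em z K w∈z λ a a∈K →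
      q≡0⇒z≤ a (≡.cong lift (¬-not λ qa≡1 →
        ⟦⟧≡false⇒¬ em (≡.cong lower max≡0) (a , a∈K , ≡.cong lift qa≡1))) w∈z)
    where
    0≢1 : ¬ (lift false ≡ lift true)
    0≢1 ()

propositionA4 : ∀ {ℓ} (em : ExcludedMiddle (suc ℓ)) (z : Ordinal ℓ) →
    Φ-Monotone (F-g em) (σ-g em) _≤₂_ ×
    IsRankingDomain em (F-g em) 𝟚-completeLattice (σ-g em) (r-g em z) (q-g em z) (_⊑Ord_ em z)
propositionA4 em z = σ-Φ-monotone em , record
  { q∘r⊑σ∘Fq            = q∘r≤σ∘Fq em z
  ; R-isCompleteLattice = ⊑Ord-isCompleteLattice em z
  ; Φ-monotone          = r-Φ-monotone em z
  ; q-monotone          = λ {a} {b} b≤a → ≤₂-from-0 λ qb≡0 →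
      z≤⇒q≡0 em z a (λ w∈z → b≤a (q≡0⇒z≤ em z b qb≡0 w∈z))
  -- The bottom of the reversed order is min ∅, which is `z` by convention.
  ; q-strict            = z≤⇒q≡0 em z (min em z ⟨$⟩ ∅ₛ)
      λ w∈z → Min.inn em z ∅ₛ w∈z λ _ ()
  ; q-continuous        = q-min em z
  ; corecursive         = r-corecursive em z
  }
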